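{- Let $G$ be an embedded graph. Then, as an identity in the indeterminate $\lambda$, $$P(G^*;\lambda)=\lambda^{c(G^{\times})}(-1)^{r(G^{\times})}R(G^{\times};1-\lambda,-\lambda,1/\lambda).$$
   Context: An embedded graph is a graph (loops and multiple edges allowed, not necessarily connected) cellularly embedded in a closed, possibly non-orientable, surface, i.e. each component of the complement (each face) is an open disc. Equivalently, it is a ribbon graph: a surface with boundary written as a union of vertex discs and edge discs (ribbons), each edge disc meeting the vertex discs in exactly two disjoint arcs. $c(G)$ is the number of connected components, $r(G)=|V(G)|-c(G)$, $n(G)=|E(G)|-r(G)$, and $f(G)$ is the number of boundary components of the ribbon graph (number of faces). For $A\subseteq E(G)$, $c(A),r(A),n(A),f(A)$ refer to the spanning ribbon subgraph $(V(G),A)$. $G^*$ is the geometric dual of $G$ (in the same surface). The partial Petrial $G^{\tau(A)}$, $A\subseteq E(G)$, is the ribbon graph obtained from $G$ by adding a half-twist to each edge in $A$, and the Petrie dual is $G^{\times}=G^{\tau(E(G))}$. Penrose polynomial: $P(G;\lambda)=\sum_{A\subseteq E(G)}(-1)^{|A|}\lambda^{f(G^{\tau(A)})}$. Ribbon graph (Bollobás–Riordan) polynomial: $R(G;x,y,z)=\sum_{A\subseteq E(G)}(x-1)^{r(G)-r(A)}y^{n(A)}z^{c(A)-f(A)+n(A)}$. -}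

module Defs where

open import Algebra.Bundles using (CommutativeRing)
open import Data.Bool.Base using (true; false; if_then_else_)
open import Data.Empty using (⊥-elim)
open import Data.Fin.Base using (Fin; punchIn; punchOut)
open import Data.Fin.Properties using
  (_≟_; punchOut-injective; punchOut-punchIn; punchInᵢ≢i; punchOut-cong)
open import Data.Fin.Subset using (Subset; inside; outside; ⊤; ∣_∣)
open import Data.List.Base using (List; []; _∷_; map; concatMap; allFin)
open import Data.List.Membership.Propositional using (_∈_)
open import Data.List.Relation.Unary.Any using (here; there)
open import Data.Nat.Base using (ℕ; zero; suc; _+_; _∸_)
open import Data.Product.Base using (∃; _×_; _,_)
open import Data.Sum.Base using (_⊎_; inj₁; inj₂)
open import Data.Vec.Base using ([]; _∷_; lookup)
open import Function.Base using (_∘_; id)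
open import Relation.Binary.Construct.Closure.Equivalence as Eq using (EqClosure)
open import Relation.Binary.Core using (Rel)
open import Relation.Binary.PropositionalEquality using
  (_≡_; _≢_; refl; sym; trans; cong; isEquivalence)
open import Relation.Nullary.Decidable.Core using (yes; no)
import Algebra.Properties.Semiring.Exp as Exp

-- Counting orbits

-- A finite quotient set.  The fields determine `count` uniquely: it is the
-- number of classes of _~_.
record Quotient {n : ℕ} (_~_ : Rel (Fin n) _) : Set where
  field
    count      : ℕ
    class      : Fin n → Fin count
    surjective : ∀ c → ∃ λ x → class x ≡ c
    sound      : ∀ {x y} → x ~ y → class x ≡ class y
    effective  : ∀ {x y} → class x ≡ class y → x ~ y

Generated : {n : ℕ} → List (Fin n × Fin n) → Rel (Fin n) _
Generated ps = EqClosure (λ x y → (x , y) ∈ ps)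

module _ {k : ℕ} (a b : Fin (suc k)) (a≢b : a ≢ b) where

  identify : Fin (suc k) → Fin k
  identify c with a ≟ c
  ... | yes _  = punchOut a≢b
  ... | no a≢c = punchOut a≢c

  identify-≡ : identify a ≡ identify b
  identify-≡ with a ≟ a | a ≟ b
  ... | no a≢a | _        = ⊥-elim (a≢a refl)
  ... | yes _  | yes a≡b  = ⊥-elim (a≢b a≡b)
  ... | yes _  | no a≢b′  = punchOut-cong a refl

  identify-surjective : ∀ c → identify (punchIn a c) ≡ c
  identify-surjective c with a ≟ punchIn a c
  ... | yes eq = ⊥-elim (punchInᵢ≢i a c (sym eq))
  ... | no _   = trans (punchOut-cong a refl) (punchOut-punchIn a)

  identify-injective : ∀ c d → identify c ≡ identify d →
    (c ≡ d) ⊎ (c ≡ a × d ≡ b) ⊎ (c ≡ b × d ≡ a)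
  identify-injective c d eq with a ≟ c | a ≟ d
  ... | yes a≡c | yes a≡d = inj₁ (trans (sym a≡c) a≡d)
  ... | yes a≡c | no a≢d  =
    inj₂ (inj₁ (sym a≡c , sym (punchOut-injective a≢b a≢d eq)))
  ... | no a≢c  | yes a≡d =
    inj₂ (inj₂ (punchOut-injective a≢c a≢b eq , sym a≡d))
  ... | no a≢c  | no a≢d  = inj₁ (punchOut-injective a≢c a≢d eq)

adjoin : {n : ℕ} {ps : List (Fin n × Fin n)} (p : Fin n × Fin n) →
  Quotient (Generated ps) → Quotient (Generated (p ∷ ps))
adjoin {n} {ps} (a , b) Q = go count class surjective sound effective
  where
  open Quotient Q

  weaken : ∀ {x y} → Generated ps x y → Generated ((a , b) ∷ ps) x y
  weaken = Eq.map there

  new : Generated ((a , b) ∷ ps) a b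
  new = Eq.return (here refl)

  _∙_ : ∀ {x y z} → Generated ((a , b) ∷ ps) x y →
    Generated ((a , b) ∷ ps) y z → Generated ((a , b) ∷ ps) x z
  _∙_ = Eq.transitive _

  go : (k : ℕ) (cl : Fin n → Fin k) → (∀ c → ∃ λ x → cl x ≡ c) →
    (∀ {x y} → Generated ps x y → cl x ≡ cl y) →
    (∀ {x y} → cl x ≡ cl y → Generated ps x y) →
    Quotient (Generated ((a , b) ∷ ps))
  go zero cl _ _ _ with () ← cl a
  go (suc k) cl surj snd eff with cl a ≟ cl b
  ... | yes same = record
    { count      = suc k
    ; class      = cl
    ; surjective = surj
    ; sound      = Eq.gfold isEquivalence cl
        λ { (here refl) → same ; (there p) → snd (Eq.return p) }
    ; effective  = weaken ∘ eff
    }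
  ... | no diff = record
    { count      = k
    ; class      = ι ∘ cl
    ; surjective = λ c → let (x , eq) = surj (punchIn (cl a) c) in
        x , trans (cong ι eq) (identify-surjective (cl a) (cl b) diff c)
    ; sound      = Eq.gfold isEquivalence (ι ∘ cl)
        λ { (here refl) → identify-≡ (cl a) (cl b) diff
          ; (there p)   → cong ι (snd (Eq.return p)) }
    ; effective  = λ {x} {y} eq →
        eff′ (identify-injective (cl a) (cl b) diff (cl x) (cl y) eq)
    }
    where
    ι : Fin (suc k) → Fin k
    ι = identify (cl a) (cl b) diff

    eff′ : ∀ {x y} →
      (cl x ≡ cl y) ⊎ (cl x ≡ cl a × cl y ≡ cl b) ⊎ (cl x ≡ cl b × cl y ≡ cl a) →
      Generated ((a , b) ∷ ps) x y
    eff′ (inj₁ eq)              = weaken (eff eq)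
    eff′ (inj₂ (inj₁ (xa , yb))) =
      weaken (eff xa) ∙ (new ∙ weaken (eff (sym yb)))
    eff′ (inj₂ (inj₂ (xb , ya))) =
      weaken (eff xb) ∙ (Eq.symmetric _ new ∙ weaken (eff (sym ya)))

quotient : {n : ℕ} (ps : List (Fin n × Fin n)) → Quotient (Generated ps)
quotient {n} [] = record
  { count      = n
  ; class      = id
  ; surjective = λ c → c , refl
  ; sound      = Eq.fold isEquivalence λ ()
  ; effective  = λ { refl → Eq.reflexive _ }
  }
quotient (p ∷ ps) = adjoin p (quotient ps)

-- The number of orbits of the group generated by the given permutations.
orbits : {n : ℕ} → List (Fin n → Fin n) → ℕ
orbits {n} gs = Quotient.count (quotient
  (concatMap (λ g → map (λ x → x , g x) (allFin n)) gs))

-- Ribbon graphs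

-- A ribbon graph is recorded by the corners of its edge discs.  Each edge disc
-- is a rectangle with four corners; two opposite sides of it are the arcs in
-- which it meets the vertex discs, the other two are free.
--   end x  : the other corner of x on the same attaching arc;
--   side x : the other corner of x on the same free side;
--   arc x  : the corner reached from x along the vertex boundary, away from the
--            edge disc of x, up to the next edge disc.
-- The gluing is arbitrary, so the surface may be non-orientable, and loops,
-- multiple edges and several components are allowed.  A vertex disc meeting no
-- edge disc has no corners; such vertices are only counted.
-- Two corners lie on the same vertex disc, the same boundary component, or the
-- same component of the ribbon graph iff they are in one orbit of
-- ⟨end, arc⟩, ⟨side, arc⟩, or ⟨end, side, arc⟩ respectively.
record RibbonGraph : Set where
  field
    #edges   : ℕ
    isolated : ℕ
    #corners : ℕ

  Corner : Set
  Corner = Fin #corners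

  field
    edge            : Corner → Fin #edges
    end side arc    : Corner → Corner

    end-involutive  : ∀ x → end (end x) ≡ x
    side-involutive : ∀ x → side (side x) ≡ x
    arc-involutive  : ∀ x → arc (arc x) ≡ x
    end-side        : ∀ x → end (side x) ≡ side (end x)
    end-free        : ∀ x → end x ≢ x
    side-free       : ∀ x → side x ≢ x
    end-side-free   : ∀ x → end (side x) ≢ x
    arc-free        : ∀ x → arc x ≢ x

    edge-surjective : ∀ e → ∃ λ x → edge x ≡ e
    edge-end        : ∀ x → edge (end x) ≡ edge x
    edge-side       : ∀ x → edge (side x) ≡ edge x
    edge-corners    : ∀ x y → edge x ≡ edge y →
      (y ≡ x) ⊎ (y ≡ end x) ⊎ (y ≡ side x) ⊎ (y ≡ end (side x))

  -- The map that is g on the corners of edges in A and h on all others.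
  piecewise : Subset #edges → (g h : Corner → Corner) → Corner → Corner
  piecewise A g h x = if lookup A (edge x) then g x else h x

-- The geometric dual: the vertex discs are removed and discs are glued to the
-- old boundary components, so attaching arcs and free sides are exchanged.
dual : RibbonGraph → RibbonGraph
dual G = record
  { #edges          = #edges
  ; isolated        = isolated
  ; #corners        = #corners
  ; edge            = edge
  ; end             = side
  ; side            = end
  ; arc             = arc
  ; end-involutive  = side-involutive
  ; side-involutive = end-involutive
  ; arc-involutive  = arc-involutive
  ; end-side        = λ x → sym (end-side x)
  ; end-free        = side-free
  ; side-free       = end-free
  ; end-side-free   = λ x eq → end-side-free x (trans (end-side x) eq)
  ; arc-free        = arc-free
  ; edge-surjective = edge-surjective
  ; edge-end        = edge-side
  ; edge-side       = edge-end
  ; edge-corners    = λ x y eq → swap (end-side x) (edge-corners x y eq)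
  }
  where
  open RibbonGraph G

  swap : ∀ {x y z u v : Corner} {w : Corner} → u ≡ v →
    (y ≡ x) ⊎ (y ≡ z) ⊎ (y ≡ w) ⊎ (y ≡ u) →
    (y ≡ x) ⊎ (y ≡ w) ⊎ (y ≡ z) ⊎ (y ≡ v)
  swap u≡v (inj₁ p)               = inj₁ p
  swap u≡v (inj₂ (inj₁ p))        = inj₂ (inj₂ (inj₁ p))
  swap u≡v (inj₂ (inj₂ (inj₁ p))) = inj₂ (inj₁ p)
  swap u≡v (inj₂ (inj₂ (inj₂ p))) = inj₂ (inj₂ (inj₂ (trans p u≡v)))

-- The partial Petrial.  After a half-twist the free side leaving the corner x
-- arrives at the other corner of the opposite attaching arc.
petrial : (G : RibbonGraph) → Subset (RibbonGraph.#edges G) → RibbonGraph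
petrial G A = record
  { #edges          = #edges
  ; isolated        = isolated
  ; #corners        = #corners
  ; edge            = edge
  ; end             = end
  ; side            = twisted
  ; arc             = arc
  ; end-involutive  = end-involutive
  ; side-involutive = involutive
  ; arc-involutive  = arc-involutive
  ; end-side        = commute
  ; end-free        = end-free
  ; side-free       = free
  ; end-side-free   = end-free′
  ; arc-free        = arc-free
  ; edge-surjective = edge-surjective
  ; edge-end        = edge-end
  ; edge-side       = edge-twisted
  ; edge-corners    = corners
  }
  where
  open RibbonGraph G

  twisted : Corner → Corner
  twisted = piecewise A (end ∘ side) side

  edge-twisted : ∀ x → edge (twisted x) ≡ edge x
  edge-twisted x with lookup A (edge x)
  ... | true  = trans (edge-end (side x)) (edge-side x)
  ... | false = edge-side x

  involutive : ∀ x → twisted (twisted x) ≡ x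
  involutive x with lookup A (edge x) in eq
  ... | true  rewrite edge-end (side x) | edge-side x | eq
                    | sym (end-side (side x)) | side-involutive x
                    = end-involutive x
  ... | false rewrite edge-side x | eq = side-involutive x

  commute : ∀ x → end (twisted x) ≡ twisted (end x)
  commute x rewrite edge-end x with lookup A (edge x)
  ... | true  = cong end (end-side x)
  ... | false = end-side x

  free : ∀ x → twisted x ≢ x
  free x with lookup A (edge x)
  ... | true  = end-side-free x
  ... | false = side-free x

  end-free′ : ∀ x → end (twisted x) ≢ x
  end-free′ x with lookup A (edge x)
  ... | true  rewrite end-involutive (side x) = side-free x
  ... | false = end-side-free x

  corners : ∀ x y → edge x ≡ edge y →
    (y ≡ x) ⊎ (y ≡ end x) ⊎ (y ≡ twisted x) ⊎ (y ≡ end (twisted x))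
  corners x y eq with lookup A (edge x) | edge-corners x y eq
  ... | false | c                      = c
  ... | true  | inj₁ p                 = inj₁ p
  ... | true  | inj₂ (inj₁ p)          = inj₂ (inj₁ p)
  ... | true  | inj₂ (inj₂ (inj₁ p))   =
    inj₂ (inj₂ (inj₂ (trans p (sym (end-involutive (side x))))))
  ... | true  | inj₂ (inj₂ (inj₂ p))   = inj₂ (inj₂ (inj₁ p))

petrieDual : RibbonGraph → RibbonGraph
petrieDual G = petrial G ⊤

-- Parameters of the spanning ribbon subgraph (V(G), A).  In `faces`, removing
-- the edge disc of x turns its attaching arcs into boundary, so a boundary
-- component passes from x to end x instead of side x.
-- The differences in `rank`, `nullity` and in the exponents below are
-- nonnegative integers, so ∸ is subtraction.
module _ (G : RibbonGraph) where
  open RibbonGraph G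

  vertices : ℕ
  vertices = isolated + orbits (end ∷ arc ∷ [])

  components faces rank nullity : Subset #edges → ℕ
  components A = isolated + orbits (end ∷ arc ∷ piecewise A side id ∷ [])
  faces A      = isolated + orbits (arc ∷ piecewise A side end ∷ [])
  rank A       = vertices ∸ components A
  nullity A    = ∣ A ∣ ∸ rank A

  c r f : ℕ
  c = components ⊤
  r = rank ⊤
  f = faces ⊤

-- Both polynomials have integer coefficients; they are given through their
-- values in an arbitrary commutative ring.
module Polynomials {a ℓ} (K : CommutativeRing a ℓ) where
  open CommutativeRing K renaming (_+_ to _⊕_)
  open Exp semiring using (_^_) public

  ∑⊆ : (m : ℕ) → (Subset m → Carrier) → Carrier
  ∑⊆ zero    t = t []
  ∑⊆ (suc m) t = ∑⊆ m (λ A → t (outside ∷ A)) ⊕ ∑⊆ m (λ A → t (inside ∷ A))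

  penrose : RibbonGraph → Carrier → Carrier
  penrose G ƛ = ∑⊆ (RibbonGraph.#edges G) λ A →
    (- 1#) ^ ∣ A ∣ * ƛ ^ f (petrial G A)

  ribbonPolynomial : RibbonGraph → (x y z : Carrier) → Carrier
  ribbonPolynomial G x y z = ∑⊆ (RibbonGraph.#edges G) λ A →
    (x - 1#) ^ (r G ∸ rank G A) * y ^ nullity G A
      * z ^ ((components G A + nullity G A) ∸ faces G A)

{-# OPTIONS --safe #-}

-- Exchanging end and side turns the boundary components of (G*)^τ(A) into those
-- of the spanning subgraph (V, A) of G^×, so the identity holds summand by
-- summand, by comparing exponents.  That the exponents are honest differences
-- rests on the bounds c(E) ≤ c(A) ≤ v ≤ c(A) + |A| and on Euler's inequality
-- f(A) + v ≤ 2 c(A) + |A|, obtained by inserting the edges of A one at a time.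
module Submission where

open import Defs
open import Algebra.Bundles using (CommutativeRing)
open import Data.Bool.Base using (true; false; if_then_else_)
open import Data.Fin.Base using (Fin; zero; suc; toℕ)
open import Data.Fin.Properties using (_≟_; pigeonhole; injective⇒≤; suc-injective)
open import Data.Fin.Subset using (Subset; inside; outside; ⊤; ⊥; ∣_∣)
open import Data.List.Base using (List; []; _∷_; map; concatMap; allFin; _++_)
open import Data.List.Membership.Propositional using (_∈_)
open import Data.List.Membership.Propositional.Properties using
  (∈-++⁻; ∈-map⁻; ∈-map⁺; ∈-concatMap⁺; ∈-allFin)
open import Data.List.Properties using (map-cong)
open import Data.List.Relation.Unary.All as All using (All; []; _∷_)
import Data.List.Relation.Unary.Any as Any
open import Data.Nat.Base using (ℕ; zero; suc; _+_; _∸_; _≤_; _<_; s≤s; s≤s⁻¹; z<s)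
open import Data.Nat.GeneralisedArithmetic using (fold)
open import Data.Nat.Induction using (<-wellFounded)
open import Data.Nat.Properties as ℕ using (module ≤-Reasoning)
open import Data.Nat.Solver using (module +-*-Solver)
open import Data.Product.Base using (∃; ∃₂; _×_; _,_; proj₁; proj₂)
open import Data.Sum.Base using (_⊎_; inj₁; inj₂)
open import Data.Vec.Base using ([]; _∷_; lookup; _[_]≔_)
open import Data.Vec.Properties using (lookup-replicate; lookup∘update; lookup∘update′)
open import Function.Base using (_∘_; id)
open import Induction.WellFounded using (Acc; acc)
import Relation.Binary.Construct.Closure.Equivalence as Eq
open import Relation.Binary.PropositionalEquality using
  (_≡_; _≢_; refl; sym; trans; cong; subst; isEquivalence; module ≡-Reasoning)
open import Relation.Nullary.Decidable.Core using (Dec; yes; no; does)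
open import Relation.Nullary.Negation.Core using (contradiction)
import Algebra.Properties.CommutativeSemigroup as CommutativeSemigroupProperties
import Algebra.Properties.CommutativeSemiring.Exp as CommutativeExp
import Algebra.Properties.Ring as RingProperties

-- Orbits

private
  variable
    n k : ℕ
    B   : Set

Invariant : (Fin n → B) → List (Fin n → Fin n) → Set
Invariant φ = All (λ g → ∀ x → φ (g x) ≡ φ x)

invariant-∘ : ∀ {C : Set} (h : B → C) {φ : Fin n → B} {gs} →
  Invariant φ gs → Invariant (h ∘ φ) gs
invariant-∘ h = All.map λ inv x → cong h (inv x)

graph : (Fin n → Fin n) → List (Fin n × Fin n)
graph g = map (λ x → x , g x) (allFin _)

orbitQuotient : (gs : List (Fin n → Fin n)) →
  Quotient (Generated (concatMap graph gs))
orbitQuotient gs = quotient (concatMap graph gs)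

orbit : (gs : List (Fin n → Fin n)) → Fin n → Fin (orbits gs)
orbit gs = Quotient.class (orbitQuotient gs)

representative : (gs : List (Fin n → Fin n)) → Fin (orbits gs) → Fin n
representative gs c = proj₁ (Quotient.surjective (orbitQuotient gs) c)

orbit-representative : (gs : List (Fin n → Fin n)) → ∀ c →
  orbit gs (representative gs c) ≡ c
orbit-representative gs c = proj₂ (Quotient.surjective (orbitQuotient gs) c)

orbit-invariant : (gs : List (Fin n → Fin n)) → Invariant (orbit gs) gs
orbit-invariant gs = All.tabulate λ g∈gs x →
  sym (Quotient.sound (orbitQuotient gs) (Eq.return
    (∈-concatMap⁺ graph (Any.map (λ { refl → ∈-map⁺ _ (∈-allFin x) }) g∈gs))))

-- Points of one orbit are linked by a chain of generator steps, taken in either direction, and `φ`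
-- is constant along each link. Every comparison of orbit counts below rests on this.
orbit-universal : {φ : Fin n → B} (gs : List (Fin n → Fin n)) → Invariant φ gs →
  ∀ {x y} → orbit gs x ≡ orbit gs y → φ x ≡ φ y
orbit-universal {φ = φ} gs inv eq =
  Eq.gfold isEquivalence φ (generator gs inv)
    (Quotient.effective (orbitQuotient gs) eq)
  where
  generator : ∀ hs → Invariant φ hs →
    ∀ {x y} → (x , y) ∈ concatMap graph hs → φ x ≡ φ y
  generator (h ∷ hs) (p ∷ ps) xy∈ with ∈-++⁻ (graph h) xy∈
  ... | inj₂ xy∈hs = generator hs ps xy∈hs
  ... | inj₁ xy∈h with z , _ , refl ← ∈-map⁻ _ xy∈h = sym (p z)

module _ (gs hs : List (Fin n → Fin n)) where

  -- By invariance each `hs`-orbit is a union of `gs`-orbits, so representatives of distinct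
  -- `hs`-orbits lie in distinct `gs`-orbits.
  orbits-≤ : Invariant (orbit hs) gs → orbits hs ≤ orbits gs
  orbits-≤ inv = injective⇒≤ {f = orbit gs ∘ representative hs} λ {c} {d} eq →
    trans (sym (orbit-representative hs c))
      (trans (orbit-universal gs inv eq) (orbit-representative hs d))

  orbits-< : Invariant (orbit hs) gs → ∀ {a b} →
    orbit hs a ≡ orbit hs b → orbit gs a ≢ orbit gs b → orbits hs < orbits gs
  orbits-< inv {a} {b} same distinct = injective⇒≤ {f = split} split-injective
    where
    -- The class shared by `a` and `b` is represented by `b`, which leaves `a` as an additional
    -- point in a `gs`-orbit of its own.
    choice : ∀ c → ∃ λ x → orbit hs x ≡ c × (orbit hs a ≡ c → x ≡ b)
    choice c with orbit hs a ≟ c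
    ... | yes eq = b , trans (sym same) eq , λ _ → refl
    ... | no neq = representative hs c , orbit-representative hs c ,
                   λ eq → contradiction eq neq

    split : Fin (suc (orbits hs)) → Fin (orbits gs)
    split zero    = orbit gs a
    split (suc c) = orbit gs (proj₁ (choice c))

    apart : ∀ c → orbit gs a ≢ orbit gs (proj₁ (choice c))
    apart c eq with x , x∈c , a∈c⇒x≡b ← choice c
      with refl ← a∈c⇒x≡b (trans (orbit-universal gs inv eq) x∈c) = distinct eq

    split-injective : ∀ {c d} → split c ≡ split d → c ≡ d
    split-injective {zero}  {zero}  _  = refl
    split-injective {zero}  {suc d} eq = contradiction eq (apart d)
    split-injective {suc c} {zero}  eq = contradiction (sym eq) (apart c)
    split-injective {suc c} {suc d} eq = cong suc
      (trans (sym (proj₁ (proj₂ (choice c))))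
        (trans (orbit-universal gs inv eq) (proj₁ (proj₂ (choice d)))))

-- The classes `u` and `v` may coincide, and then this is the identity; otherwise exactly one class
-- is lost.
merge : (u v : Fin k) → Fin k → Fin k
merge u v c = if does (c ≟ v) then u else c

merge-≡ : (u v : Fin k) → merge u v u ≡ merge u v v
merge-≡ u v with u ≟ v | v ≟ v
... | yes _ | yes _   = refl
... | no _  | yes _   = refl
... | _     | no v≢v  = contradiction refl v≢v

merge-injective : (u v : Fin k) → ∀ {c d} → c ≢ v → d ≢ v →
  merge u v c ≡ merge u v d → c ≡ d
merge-injective u v {c} {d} c≢v d≢v eq with c ≟ v | d ≟ v
... | yes c≡v | _       = contradiction c≡v c≢v
... | no _    | yes d≡v = contradiction d≡v d≢v
... | no _    | no _    = eq

-- The merged classes are unions of `hs`-orbits, so at most `orbits hs` of them occur, and merging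
-- loses at most one class. The extra element `zero` absorbs `v`, off which `merge u v` is
-- injective.
orbits-≤-suc : (gs hs : List (Fin n → Fin n)) (u v : Fin (orbits gs)) →
  Invariant (merge u v ∘ orbit gs) hs → orbits gs ≤ suc (orbits hs)
orbits-≤-suc gs hs u v inv =
  injective⇒≤ {f = λ c → collapse c (c ≟ v)} λ {c} {d} →
    collapse-injective c d (c ≟ v) (d ≟ v)
  where
  collapse : ∀ c → Dec (c ≡ v) → Fin (suc (orbits hs))
  collapse c (yes _) = zero
  collapse c (no _)  = suc (orbit hs (representative gs c))

  collapse-injective : ∀ c d c≟v d≟v → collapse c c≟v ≡ collapse d d≟v → c ≡ d
  collapse-injective c d (yes c≡v) (yes d≡v) _  = trans c≡v (sym d≡v)
  collapse-injective c d (no c≢v)  (no d≢v)  eq = merge-injective u v c≢v d≢v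
    (trans (cong (merge u v) (sym (orbit-representative gs c)))
      (trans (orbit-universal hs inv (suc-injective eq))
        (cong (merge u v) (orbit-representative gs d))))

halve : ∀ d → ∃ λ j → (d ≡ j + j) ⊎ (d ≡ suc (j + j))
halve zero    = zero , inj₁ refl
halve (suc d) with halve d
... | j , inj₁ refl = j , inj₂ refl
... | j , inj₂ refl = suc j , inj₁ (cong suc (sym (ℕ.+-suc j j)))

-- An orbit of two involutions is a cycle or a path.  Walking from an end point a
-- of a path, the walk m ∘ g returns after some period d; m reflects the walk, so
-- half way through the period sits a fixed point of m if d is even, of g if d is
-- odd.  If the former is a itself, the period is halved.
module _ (g m : Fin n → Fin n)
  (g-involutive : ∀ x → g (g x) ≡ x) (m-involutive : ∀ x → m (m x) ≡ x)
  (g-free : ∀ x → g x ≢ x) (a : Fin n) (m-fixes-a : m a ≡ a) where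

  private
    walk : ℕ → Fin n
    walk = fold a (m ∘ g)

    walk-cancel : ∀ i d → walk i ≡ walk (i + d) → a ≡ walk d
    walk-cancel zero    d eq = eq
    walk-cancel (suc i) d eq = walk-cancel i d
      (involutive-injective g g-involutive (involutive-injective m m-involutive eq))
      where
      involutive-injective : ∀ (h : Fin n → Fin n) → (∀ x → h (h x) ≡ x) →
        ∀ {x y} → h x ≡ h y → x ≡ y
      involutive-injective h inv {x} {y} eq =
        trans (sym (inv x)) (trans (cong h eq) (inv y))

    periodic : ∃ λ d → a ≡ walk (suc d)
    periodic with pigeonhole (ℕ.n<1+n n) (walk ∘ toℕ)
    -- The period `j - i` is written as a successor to record that it is positive.
    ... | i , j , i<j , eq = toℕ j ∸ suc (toℕ i) ,
      walk-cancel (toℕ i) _ (trans eq (cong walk (sym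
        (trans (ℕ.+-suc (toℕ i) _) (ℕ.m+[n∸m]≡n i<j)))))

    -- `m` conjugates the step `m ∘ g` to its inverse `g ∘ m`, and it fixes `a`, the position at
    -- both times `0` and `d`.
    reflect : ∀ d → a ≡ walk d → ∀ i j → i + j ≡ d → m (walk i) ≡ walk j
    reflect d return zero    j refl = trans m-fixes-a return
    reflect d return (suc i) j eq   = begin
      m (m (g (walk i)))       ≡⟨ m-involutive _ ⟩
      g (walk i)               ≡⟨ cong g (m-involutive _) ⟨
      g (m (m (walk i)))       ≡⟨ cong (g ∘ m)
                                    (reflect d return i (suc j) (trans (ℕ.+-suc i j) eq)) ⟩
      g (m (m (g (walk j))))   ≡⟨ cong g (m-involutive _) ⟩
      g (g (walk j))           ≡⟨ g-involutive _ ⟩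
      walk j                   ∎
      where open ≡-Reasoning

    halfway : ∀ d → Acc _<_ d → 0 < d → a ≡ walk d →
      ∃ λ i → walk i ≢ a × m (walk i) ≡ walk i
    halfway d (acc smaller) 0<d return with halve d
    -- For `d = 2j + 1` the reflection exchanges the consecutive times `j + 1` and `j`; cancelling
    -- `m` makes `walk j` a fixed point of `g`.
    ... | j , inj₂ refl = contradiction
      (trans (sym (m-involutive _)) (reflect d return (suc j) j refl)) (g-free (walk j))
    ... | suc j , inj₁ refl with walk (suc j) ≟ a
    ...   | no away = suc j , away , reflect d return (suc j) (suc j) refl
    ...   | yes eq  = halfway (suc j) (smaller (ℕ.m<m+n (suc j) z<s)) z<s (sym eq)

  other-end : ∃ λ b → b ≢ a × m b ≡ b × orbit (g ∷ m ∷ []) b ≡ orbit (g ∷ m ∷ []) a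
  other-end =
    let d , return   = periodic
        i , away , eq = halfway (suc d) (<-wellFounded _) z<s return
    in walk i , away , eq , same-orbit i
    where
    same-orbit : ∀ i → orbit (g ∷ m ∷ []) (walk i) ≡ orbit (g ∷ m ∷ []) a
    same-orbit zero    = refl
    same-orbit (suc i) with orbit-invariant (g ∷ m ∷ [])
    ... | g-inv ∷ m-inv ∷ [] = trans (m-inv _) (trans (g-inv _) (same-orbit i))

-- Inserting an edge

∣insert∣ : (A : Subset k) (e : Fin k) → lookup A e ≡ outside →
  ∣ A [ e ]≔ inside ∣ ≡ suc ∣ A ∣
∣insert∣ (outside ∷ A) zero    _   = refl
∣insert∣ (outside ∷ A) (suc e) e∉A = ∣insert∣ A e e∉A
∣insert∣ (inside ∷ A)  (suc e) e∉A = cong suc (∣insert∣ A e e∉A)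

-- The tail is built up first behind an `outside` head, and the head is inserted last.
subset-induction : (P : Subset k → Set) → P ⊥ →
  (∀ A e → lookup A e ≡ outside → P A → P (A [ e ]≔ inside)) → ∀ A → P A
subset-induction P base step [] = base
subset-induction P base step (x ∷ A) with x | subset-induction (P ∘ (outside ∷_)) base
  (λ A e → step (outside ∷ A) (suc e)) A
... | outside | pA = pA
... | inside  | pA = step (outside ∷ A) zero refl pA

module _ (G : RibbonGraph) where
  open RibbonGraph G

  faceMaps componentMaps : Subset #edges → List (Corner → Corner)
  faceMaps A      = arc ∷ piecewise A side end ∷ []
  componentMaps A = end ∷ arc ∷ piecewise A side id ∷ []

  piecewise-∈ : ∀ A g h {x} → lookup A (edge x) ≡ inside → piecewise A g h x ≡ g x
  piecewise-∈ A g h {x} eq with lookup A (edge x)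
  piecewise-∈ A g h {x} refl | true = refl

  piecewise-∉ : ∀ A g h {x} → lookup A (edge x) ≡ outside → piecewise A g h x ≡ h x
  piecewise-∉ A g h {x} eq with lookup A (edge x)
  piecewise-∉ A g h {x} refl | false = refl

  piecewise-invariant : ∀ A {g h} {φ : Corner → B} →
    (∀ x → lookup A (edge x) ≡ inside  → φ (g x) ≡ φ x) →
    (∀ x → lookup A (edge x) ≡ outside → φ (h x) ≡ φ x) →
    ∀ x → φ (piecewise A g h x) ≡ φ x
  piecewise-invariant A in-A not-in-A x with lookup A (edge x) in eq
  ... | true  = in-A x eq
  ... | false = not-in-A x eq

  components-inclusion : ∀ A → components G ⊤ ≤ components G A
  components-inclusion A with orbit-invariant (componentMaps ⊤)
  ... | end-inv ∷ arc-inv ∷ side-inv ∷ [] =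
    ℕ.+-monoʳ-≤ isolated (orbits-≤ (componentMaps A) (componentMaps ⊤)
    (end-inv ∷ arc-inv ∷ piecewise-invariant A
      (λ x _ → trans
        (cong (orbit (componentMaps ⊤))
          (sym (piecewise-∈ ⊤ side id (lookup-replicate (edge x) inside))))
        (side-inv x))
      (λ _ _ → refl) ∷ []))

  components≤vertices : ∀ A → components G A ≤ vertices G
  components≤vertices A with orbit-invariant (componentMaps A)
  ... | end-inv ∷ arc-inv ∷ _ = ℕ.+-monoʳ-≤ isolated
    (orbits-≤ (end ∷ arc ∷ []) (componentMaps A) (end-inv ∷ arc-inv ∷ []))

  lookup-⊥≢inside : ∀ (e : Fin #edges) → lookup ⊥ e ≢ inside
  lookup-⊥≢inside e eq with () ← trans (sym eq) (lookup-replicate e outside)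

  vertices≤components-⊥ : vertices G ≤ components G ⊥
  vertices≤components-⊥ with orbit-invariant (end ∷ arc ∷ [])
  ... | end-inv ∷ arc-inv ∷ [] =
    ℕ.+-monoʳ-≤ isolated (orbits-≤ (componentMaps ⊥) (end ∷ arc ∷ [])
    (end-inv ∷ arc-inv ∷ piecewise-invariant ⊥
      (λ x eq → contradiction eq (lookup-⊥≢inside (edge x))) (λ _ _ → refl) ∷ []))

  -- With no edges present, a boundary component runs once around a vertex disc.
  faces-⊥≤vertices : faces G ⊥ ≤ vertices G
  faces-⊥≤vertices with orbit-invariant (faceMaps ⊥)
  ... | arc-inv ∷ end-inv ∷ [] =
    ℕ.+-monoʳ-≤ isolated (orbits-≤ (end ∷ arc ∷ []) (faceMaps ⊥)
    ((λ x → trans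
        (cong (orbit (faceMaps ⊥))
          (sym (piecewise-∉ ⊥ side end (lookup-replicate (edge x) outside))))
        (end-inv x))
      ∷ arc-inv ∷ []))

  module Insertion (A : Subset #edges) (e : Fin #edges) (e∉A : lookup A e ≡ outside) where

    A+e : Subset #edges
    A+e = A [ e ]≔ inside

    -- The attaching arcs of `e` have corners `a`, `end a` and `side a`, `end (side a)`, so `a` and
    -- `side a` stand for the two ends of the edge.
    a : Corner
    a = proj₁ (edge-surjective e)

    edge-a : edge a ≡ e
    edge-a = proj₂ (edge-surjective e)

    lookup-e : ∀ {x} → edge x ≡ e → lookup A+e (edge x) ≡ inside
    lookup-e refl = lookup∘update e A inside

    lookup-≢e : ∀ {x} → edge x ≢ e → lookup A+e (edge x) ≡ lookup A (edge x)
    lookup-≢e x∉e = lookup∘update′ x∉e A inside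

    lookup-A-e : ∀ {x} → edge x ≡ e → lookup A (edge x) ≡ outside
    lookup-A-e refl = e∉A

    piecewise-+e : ∀ g h {x} → edge x ≢ e → piecewise A+e g h x ≡ piecewise A g h x
    piecewise-+e g h x∉e =
      cong (λ b → if b then g _ else h _) (lookup-≢e x∉e)

    on-corners : (P : Corner → Set) → P a → P (end a) → P (side a) → P (end (side a)) →
      ∀ x → edge x ≡ e → P x
    on-corners P p q r s x x∈e with edge-corners a x (trans edge-a (sym x∈e))
    ... | inj₁ refl               = p
    ... | inj₂ (inj₁ refl)        = q
    ... | inj₂ (inj₂ (inj₁ refl)) = r
    ... | inj₂ (inj₂ (inj₂ refl)) = s

    -- One equation settles all four corners of `e`: `φ` ignores `end`, which commutes with `side`.
    componentMaps-+e : {φ : Corner → B} → φ (side a) ≡ φ a →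
      Invariant φ (componentMaps A) → Invariant φ (componentMaps A+e)
    componentMaps-+e {φ = φ} joined (end-inv ∷ arc-inv ∷ side-inv ∷ []) =
      end-inv ∷ arc-inv ∷ side-inv′ ∷ []
      where
      across : ∀ x → φ (side x) ≡ φ x → φ (side (end x)) ≡ φ (end x)
      across x eq = begin
        φ (side (end x)) ≡⟨ cong φ (end-side x) ⟨
        φ (end (side x)) ≡⟨ end-inv (side x) ⟩
        φ (side x)       ≡⟨ eq ⟩
        φ x              ≡⟨ end-inv x ⟨
        φ (end x)        ∎
        where open ≡-Reasoning

      joined′ : φ (side (side a)) ≡ φ (side a)
      joined′ = trans (cong φ (side-involutive a)) (sym joined)

      side-inv′ : ∀ x → φ (piecewise A+e side id x) ≡ φ x
      side-inv′ x with edge x ≟ e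
      ... | yes x∈e = trans (cong φ (piecewise-∈ A+e side id (lookup-e x∈e)))
        (on-corners (λ y → φ (side y) ≡ φ y)
          joined (across a joined) joined′ (across (side a) joined′) x x∈e)
      ... | no x∉e  = trans (cong φ (piecewise-+e side id x∉e)) (side-inv x)

    -- Merging the components at the two ends of `e` makes the class map of `A` invariant for `A+e`.
    components-≤-suc : components G A ≤ suc (components G A+e)
    components-≤-suc = begin
      isolated + orbits (componentMaps A)          ≤⟨ ℕ.+-monoʳ-≤ isolated merged ⟩
      isolated + suc (orbits (componentMaps A+e))  ≡⟨ ℕ.+-suc isolated _ ⟩
      suc (components G A+e)                       ∎
      where
      open ≤-Reasoning
      κ = orbit (componentMaps A)
      merged : orbits (componentMaps A) ≤ suc (orbits (componentMaps A+e))
      merged = orbits-≤-suc (componentMaps A) (componentMaps A+e) (κ a) (κ (side a))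
        (componentMaps-+e (sym (merge-≡ (κ a) (κ (side a))))
          (invariant-∘ (merge (κ a) (κ (side a))) (orbit-invariant (componentMaps A))))

    -- Between the boundaries of A and of A + e: the disc of e is cut off, but its
    -- attaching arcs are not yet made part of the boundary, so the corners of e are
    -- the ends of two paths.
    open-end : Corner → Corner
    open-end x = if does (edge x ≟ e) then x else piecewise A side end x

    open-end-∈ : ∀ {x} → edge x ≡ e → open-end x ≡ x
    open-end-∈ {x} x∈e with edge x ≟ e
    ... | yes _   = refl
    ... | no x∉e  = contradiction x∈e x∉e

    open-end-∉ : ∀ {x} → edge x ≢ e → open-end x ≡ piecewise A side end x
    open-end-∉ {x} x∉e with edge x ≟ e
    ... | yes x∈e = contradiction x∈e x∉e
    ... | no _    = refl

    edge-piecewise : ∀ x → edge (piecewise A side end x) ≡ edge x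
    edge-piecewise = piecewise-invariant A (λ x _ → edge-side x) (λ x _ → edge-end x)

    piecewise-free : ∀ x → piecewise A side end x ≢ x
    piecewise-free x with lookup A (edge x)
    ... | true  = side-free x
    ... | false = end-free x

    piecewise-involutive : ∀ x → piecewise A side end (piecewise A side end x) ≡ x
    piecewise-involutive x with lookup A (edge x) in eq
    ... | true  = trans
      (piecewise-∈ A side end (trans (cong (lookup A) (edge-side x)) eq)) (side-involutive x)
    ... | false = trans
      (piecewise-∉ A side end (trans (cong (lookup A) (edge-end x)) eq)) (end-involutive x)

    open-end-involutive : ∀ x → open-end (open-end x) ≡ x
    open-end-involutive x with edge x ≟ e
    ... | yes x∈e = open-end-∈ x∈e
    ... | no x∉e  = trans (open-end-∉ (x∉e ∘ trans (sym (edge-piecewise x))))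
                          (piecewise-involutive x)

    open-end-fixed : ∀ {x} → open-end x ≡ x → edge x ≡ e
    open-end-fixed {x} fixed with edge x ≟ e
    ... | yes x∈e = x∈e
    ... | no _    = contradiction fixed (piecewise-free x)

    openMaps : List (Corner → Corner)
    openMaps = arc ∷ open-end ∷ []

    π : Corner → Fin (orbits openMaps)
    π = orbit openMaps

    open-end-invariant : {φ : Corner → B} →
      (∀ x → edge x ≢ e → φ (piecewise A side end x) ≡ φ x) →
      ∀ x → φ (open-end x) ≡ φ x
    open-end-invariant inv x with edge x ≟ e
    ... | yes _   = refl
    ... | no x∉e  = inv x x∉e

    -- `open-end` fixes only the corners of `e`, so the path that starts at `x` must stop at one of
    -- the other three.
    path : ∀ x → edge x ≡ e →
      (π (end x) ≡ π x) ⊎ (π (side x) ≡ π x) ⊎ (π (end (side x)) ≡ π x)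
    path x x∈e
      with other-end arc open-end arc-involutive open-end-involutive arc-free x (open-end-∈ x∈e)
    ... | y , y≢x , fixed , same
      with edge-corners x y (trans x∈e (sym (open-end-fixed fixed)))
    ...   | inj₁ y≡x                = contradiction y≡x y≢x
    ...   | inj₂ (inj₁ refl)        = inj₁ same
    ...   | inj₂ (inj₂ (inj₁ refl)) = inj₂ (inj₁ same)
    ...   | inj₂ (inj₂ (inj₂ refl)) = inj₂ (inj₂ same)

    -- As `e` is not in `A`, the boundary of `A` arises from the open paths by joining corners of
    -- `e` along `end`; one equation per attaching arc suffices because `end` is an involution.
    faceMaps-invariant : {φ : Corner → B} → Invariant φ openMaps →
      φ (end a) ≡ φ a → φ (end (side a)) ≡ φ (side a) → Invariant φ (faceMaps A)
    faceMaps-invariant {φ = φ} (arc-inv ∷ open-inv ∷ []) eqᵃ eqˢ = arc-inv ∷ inv ∷ []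
      where
      inv : ∀ x → φ (piecewise A side end x) ≡ φ x
      inv x with edge x ≟ e
      ... | yes x∈e = trans (cong φ (piecewise-∉ A side end (lookup-A-e x∈e)))
        (on-corners (λ y → φ (end y) ≡ φ y)
          eqᵃ (trans (cong φ (end-involutive a)) (sym eqᵃ))
          eqˢ (trans (cong φ (end-involutive (side a))) (sym eqˢ)) x x∈e)
      ... | no x∉e = trans (cong φ (sym (open-end-∉ x∉e))) (open-inv x)

    -- Away from `e` the maps agree, and at the corners of `e` the map `open-end` imposes no
    -- relation.
    faceMaps-+e-coarser : Invariant (orbit (faceMaps A+e)) openMaps
    faceMaps-+e-coarser with orbit-invariant (faceMaps A+e)
    ... | arc-inv ∷ inv ∷ [] = arc-inv ∷ open-end-invariant (λ x x∉e →
      trans (cong (orbit (faceMaps A+e)) (sym (piecewise-+e side end x∉e))) (inv x)) ∷ []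

    -- However the two paths join the corners of e, at most one identification of
    -- them is needed for each end of e to lie in one class.
    ends-merged : ∃₂ λ u v → merge u v (π (end a)) ≡ merge u v (π a) ×
      merge u v (π (end (side a))) ≡ merge u v (π (side a))
    ends-merged = cases (path a edge-a) (path (end a) (trans (edge-end a) edge-a))
      where
      α = π a
      α′ = π (end a)
      β = π (side a)
      β′ = π (end (side a))

      Merged : Set
      Merged = ∃₂ λ u v → merge u v α′ ≡ merge u v α × merge u v β′ ≡ merge u v β

      -- One attaching arc is already closed up, so the single merger is spent on the other.
      closed : α′ ≡ α → Merged
      closed eq = β , β′ , cong (merge β β′) eq , sym (merge-≡ β β′)

      crossing : β′ ≡ α → β ≡ α′ → Merged
      crossing eq eq′ = α , α′ , sym (merge-≡ α α′) ,
        trans (cong (merge α α′) eq) (trans (merge-≡ α α′) (cong (merge α α′) (sym eq′)))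

      parallel : β ≡ α → β′ ≡ α′ → Merged
      parallel eq eq′ = α , α′ , sym (merge-≡ α α′) ,
        trans (cong (merge α α′) eq′)
          (trans (sym (merge-≡ α α′)) (cong (merge α α′) (sym eq)))

      side-end≡β′ : π (side (end a)) ≡ β′
      side-end≡β′ = cong π (sym (end-side a))

      end-side-end≡β : π (end (side (end a))) ≡ β
      end-side-end≡β = cong π (trans (cong end (sym (end-side a))) (end-involutive (side a)))

      cases : (α′ ≡ α) ⊎ (β ≡ α) ⊎ (β′ ≡ α) →
        (π (end (end a)) ≡ α′) ⊎ (π (side (end a)) ≡ α′) ⊎ (π (end (side (end a))) ≡ α′) →
        Merged
      cases (inj₁ eq) _ = closed eq
      cases _ (inj₁ eq) = closed (trans (sym eq) (cong π (end-involutive a)))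
      cases (inj₂ (inj₁ eq)) (inj₂ (inj₁ eq′)) = parallel eq (trans (sym side-end≡β′) eq′)
      -- In this case and the next, `a` and `end a` share the class of a third corner, so their own
      -- classes coincide.
      cases (inj₂ (inj₂ eq)) (inj₂ (inj₁ eq′)) = closed
        (trans (sym eq′) (trans side-end≡β′ eq))
      cases (inj₂ (inj₁ eq)) (inj₂ (inj₂ eq′)) = closed
        (trans (sym eq′) (trans end-side-end≡β eq))
      cases (inj₂ (inj₂ eq)) (inj₂ (inj₂ eq′)) = crossing eq (trans (sym end-side-end≡β) eq′)

    -- The open paths lie between the two boundaries: completing them for `A+e` only identifies
    -- classes, and completing them for `A` costs at most one class.
    faces-≤-suc : faces G A+e ≤ suc (faces G A)
    faces-≤-suc = begin
      isolated + orbits (faceMaps A+e)      ≤⟨ ℕ.+-monoʳ-≤ isolated coarser ⟩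
      isolated + orbits openMaps            ≤⟨ ℕ.+-monoʳ-≤ isolated merged ⟩
      isolated + suc (orbits (faceMaps A))  ≡⟨ ℕ.+-suc isolated _ ⟩
      suc (faces G A)                       ∎
      where
      open ≤-Reasoning
      coarser : orbits (faceMaps A+e) ≤ orbits openMaps
      coarser = orbits-≤ openMaps (faceMaps A+e) faceMaps-+e-coarser

      merged : orbits openMaps ≤ suc (orbits (faceMaps A))
      merged with u , v , eqᵃ , eqˢ ← ends-merged =
        orbits-≤-suc openMaps (faceMaps A) u v (faceMaps-invariant
          (invariant-∘ (merge u v) (orbit-invariant openMaps)) eqᵃ eqˢ)

    -- A bridge separates its two sides, so the paths close up along its ends.
    module _ (bridge : orbit (componentMaps A) (side a) ≢ orbit (componentMaps A) a) where

      private
        κ = orbit (componentMaps A)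

      κ-invariant : Invariant κ openMaps
      κ-invariant with orbit-invariant (componentMaps A)
      ... | end-inv ∷ arc-inv ∷ side-inv ∷ [] = arc-inv ∷ open-end-invariant (λ x _ →
        piecewise-invariant A
          (λ y y∈A → trans (cong κ (sym (piecewise-∈ A side id y∈A))) (side-inv y))
          (λ y _ → end-inv y) x) ∷ []

      κ-end : ∀ x → κ (end x) ≡ κ x
      κ-end with orbit-invariant (componentMaps A)
      ... | end-inv ∷ _ = end-inv

      π⇒κ : ∀ {x y} → π x ≡ π y → κ x ≡ κ y
      π⇒κ = orbit-universal openMaps κ-invariant

      -- The path from `x` stays in one component of `A`, so it cannot reach the other end of `e`
      -- and must stop at `end x`.
      π-end : ∀ x → edge x ≡ e → κ (side x) ≢ κ x → π (end x) ≡ π x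
      π-end x x∈e separated with path x x∈e
      ... | inj₁ eq        = eq
      ... | inj₂ (inj₁ eq) = contradiction (π⇒κ eq) separated
      ... | inj₂ (inj₂ eq) =
        contradiction (trans (sym (κ-end (side x))) (π⇒κ eq)) separated

      -- Completing the paths for `A` identifies nothing new by `π-end`, whereas `A+e` joins `a` to
      -- `side a`, which lie on different paths.
      bridge-faces : faces G A+e < faces G A
      bridge-faces = ℕ.+-monoʳ-< isolated (ℕ.<-≤-trans
        (orbits-< openMaps (faceMaps A+e) faceMaps-+e-coarser crossed (bridge ∘ π⇒κ))
        (orbits-≤ (faceMaps A) openMaps (faceMaps-invariant (orbit-invariant openMaps)
          (π-end a edge-a bridge)
          (π-end (side a) (trans (edge-side a) edge-a)
            (bridge ∘ sym ∘ trans (cong κ (sym (side-involutive a))))))))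
        where
        crossed : orbit (faceMaps A+e) (side a) ≡ orbit (faceMaps A+e) a
        crossed with orbit-invariant (faceMaps A+e)
        ... | _ ∷ inv ∷ [] =
          trans (cong (orbit (faceMaps A+e)) (sym (piecewise-∈ A+e side end (lookup-e edge-a)))) (inv a)

    non-bridge-components : orbit (componentMaps A) (side a) ≡ orbit (componentMaps A) a →
      components G A ≤ components G A+e
    non-bridge-components joined = ℕ.+-monoʳ-≤ isolated
      (orbits-≤ (componentMaps A+e) (componentMaps A) (componentMaps-+e joined (orbit-invariant (componentMaps A))))

  -- Nullity and Euler genus are nonnegative

  open ≤-Reasoning

  -- Each insertion raises the number of edges by one and lowers the number of components by at most
  -- one.
  vertices-bound : ∀ A → vertices G ≤ components G A + ∣ A ∣
  vertices-bound = subset-induction _ (ℕ.m≤n⇒m≤n+o _ vertices≤components-⊥)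
    λ A e e∉A bound → let open Insertion A e e∉A in begin
      vertices G                          ≤⟨ bound ⟩
      components G A + ∣ A ∣              ≤⟨ ℕ.+-monoˡ-≤ ∣ A ∣ components-≤-suc ⟩
      suc (components G A+e) + ∣ A ∣      ≡⟨ ℕ.+-suc _ _ ⟨
      components G A+e + suc ∣ A ∣        ≡⟨ cong (components G A+e +_) (∣insert∣ A e e∉A) ⟨
      components G A+e + ∣ A+e ∣          ∎

  -- Nonnegativity of the Euler genus `2c - v + e - f` of the spanning subgraph, written without
  -- truncated subtraction.
  EulerInequality : Subset #edges → Set
  EulerInequality A = faces G A + vertices G ≤ (components G A + components G A) + ∣ A ∣

  -- If `e` joins corners of one component, `f` grows by at most one, which the new edge pays for.
  -- If `e` is a bridge, `f` drops by at least one, while the right side loses at most two for the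
  -- components and gains one for the edge.
  euler-inequality : ∀ A → EulerInequality A
  euler-inequality = subset-induction EulerInequality base step
    where
    base : EulerInequality ⊥
    base = ℕ.m≤n⇒m≤n+o _ (ℕ.+-mono-≤
      (ℕ.≤-trans faces-⊥≤vertices vertices≤components-⊥) vertices≤components-⊥)

    step : ∀ A e → lookup A e ≡ outside → EulerInequality A → EulerInequality (A [ e ]≔ inside)
    step A e e∉A bound
      with orbit (componentMaps A) (side (Insertion.a A e e∉A))
             ≟ orbit (componentMaps A) (Insertion.a A e e∉A)
    ... | yes joined = let open Insertion A e e∉A in begin
      faces G A+e + vertices G
        ≤⟨ ℕ.+-monoˡ-≤ (vertices G) faces-≤-suc ⟩
      suc (faces G A + vertices G)
        ≤⟨ s≤s bound ⟩
      suc (components G A + components G A + ∣ A ∣)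
        ≡⟨ ℕ.+-suc _ _ ⟨
      components G A + components G A + suc ∣ A ∣
        ≤⟨ ℕ.+-monoˡ-≤ (suc ∣ A ∣)
             (ℕ.+-mono-≤ (non-bridge-components joined) (non-bridge-components joined)) ⟩
      components G A+e + components G A+e + suc ∣ A ∣
        ≡⟨ cong (components G A+e + components G A+e +_) (∣insert∣ A e e∉A) ⟨
      components G A+e + components G A+e + ∣ A+e ∣ ∎
    ... | no bridge = let open Insertion A e e∉A in s≤s⁻¹ (begin
      suc (faces G A+e + vertices G)
        ≤⟨ ℕ.+-monoˡ-≤ (vertices G) (bridge-faces bridge) ⟩
      faces G A + vertices G
        ≤⟨ bound ⟩
      components G A + components G A + ∣ A ∣
        ≤⟨ ℕ.+-monoˡ-≤ ∣ A ∣ (ℕ.+-mono-≤ components-≤-suc components-≤-suc) ⟩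
      suc (components G A+e) + suc (components G A+e) + ∣ A ∣
        ≡⟨ solve 2 (λ c m → (con 1 :+ c) :+ (con 1 :+ c) :+ m
             := con 1 :+ (c :+ c :+ (con 1 :+ m))) refl (components G A+e) ∣ A ∣ ⟩
      suc (components G A+e + components G A+e + suc ∣ A ∣)
        ≡⟨ cong (λ m → suc (components G A+e + components G A+e + m)) (∣insert∣ A e e∉A) ⟨
      suc (components G A+e + components G A+e + ∣ A+e ∣) ∎)
      where open +-*-Solver

-- Comparison of the polynomials

-- The generating maps agree corner by corner. On `A` both sides compose `end` and `side`, in
-- opposite orders. Off `A` both use `end`: in the dual it is the untwisted free side, in the
-- subgraph it is the arc left by the deleted edge.
faces-dual-petrial : ∀ G A → f (petrial (dual G) A) ≡ faces (petrieDual G) A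
faces-dual-petrial G A = cong (λ ps → isolated + Quotient.count (quotient (graph arc ++ ps ++ [])))
  (map-cong (λ x → cong (x ,_) (same x)) (allFin #corners))
  where
  open RibbonGraph G
  module D = RibbonGraph (petrial (dual G) A)
  module H = RibbonGraph (petrieDual G)

  same : ∀ x → D.piecewise ⊤ D.side D.end x ≡ H.piecewise A H.side H.end x
  same x rewrite lookup-replicate (edge x) inside with lookup A (edge x)
  ... | true  = sym (end-side x)
  ... | false = refl

-- Identities in the coefficient ring

module _ {a ℓ} (K : CommutativeRing a ℓ) where
  open CommutativeRing K renaming (_+_ to _⊕_; refl to ≈-refl; sym to ≈-sym; trans to ≈-trans)
  open Polynomials K
  open CommutativeSemigroupProperties *-commutativeSemigroup using (interchange)
  open CommutativeExp commutativeSemiring using (^-distrib-*; ^-congˡ; ^-congʳ; ^-homo-*)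
  open RingProperties ring using (-1*x≈-x; -‿involutive)
  open import Relation.Binary.Reasoning.Setoid setoid

  ∑⊆-cong : ∀ m {s t : Subset m → Carrier} → (∀ A → s A ≈ t A) → ∑⊆ m s ≈ ∑⊆ m t
  ∑⊆-cong zero    s≈t = s≈t []
  ∑⊆-cong (suc m) s≈t = +-cong (∑⊆-cong m (s≈t ∘ (outside ∷_))) (∑⊆-cong m (s≈t ∘ (inside ∷_)))

  *-distribˡ-∑⊆ : ∀ m x (t : Subset m → Carrier) → x * ∑⊆ m t ≈ ∑⊆ m (λ A → x * t A)
  *-distribˡ-∑⊆ zero    x t = ≈-refl
  *-distribˡ-∑⊆ (suc m) x t = ≈-trans (distribˡ x _ _)
    (+-cong (*-distribˡ-∑⊆ m x _) (*-distribˡ-∑⊆ m x _))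

  1^n≈1 : ∀ n → 1# ^ n ≈ 1#
  1^n≈1 zero    = ≈-refl
  1^n≈1 (suc n) = ≈-trans (*-identityˡ _) (1^n≈1 n)

  -1^[n+n]≈1 : ∀ n → (- 1#) ^ (n + n) ≈ 1#
  -1^[n+n]≈1 n = begin
    (- 1#) ^ (n + n)          ≈⟨ ^-homo-* (- 1#) n n ⟩
    (- 1#) ^ n * (- 1#) ^ n   ≈⟨ ^-distrib-* (- 1#) (- 1#) n ⟨
    (- 1# * - 1#) ^ n         ≈⟨ ^-congˡ n (≈-trans (-1*x≈-x (- 1#)) (-‿involutive 1#)) ⟩
    1# ^ n                    ≈⟨ 1^n≈1 n ⟩
    1#                        ∎

  [1-x]-1≈-x : ∀ x → (1# - x) - 1# ≈ - x
  [1-x]-1≈-x x = begin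
    (1# ⊕ - x) ⊕ - 1#   ≈⟨ +-congʳ (+-comm 1# (- x)) ⟩
    (- x ⊕ 1#) ⊕ - 1#   ≈⟨ +-assoc (- x) 1# (- 1#) ⟩
    - x ⊕ (1# ⊕ - 1#)   ≈⟨ +-congˡ (-‿inverseʳ 1#) ⟩
    - x ⊕ 0#            ≈⟨ +-identityʳ (- x) ⟩
    - x                 ∎

  -x^n≈-1^n*x^n : ∀ x n → (- x) ^ n ≈ (- 1#) ^ n * x ^ n
  -x^n≈-1^n*x^n x n = ≈-trans (^-congˡ n (≈-sym (-1*x≈-x x))) (^-distrib-* (- 1#) x n)

  module _ (ƛ ƛ⁻¹ : Carrier) (inverse : ƛ * ƛ⁻¹ ≈ 1#) where

    -- Since `x - 1` and `y` are both `- ƛ`, their powers combine to exponent `s + ν` and split into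
    -- a sign and a power of `ƛ`. The surplus sign exponent `s + s` is even, and `ƛ⁻¹ ^ t` cancels
    -- `ƛ ^ t`.
    summand : ∀ c₀ r s ν t φ m → r + (s + ν) ≡ m + (s + s) → c₀ + (s + ν) ≡ φ + t →
      (- 1#) ^ m * ƛ ^ φ
        ≈ ƛ ^ c₀ * (- 1#) ^ r * (((1# - ƛ) - 1#) ^ s * (- ƛ) ^ ν * ƛ⁻¹ ^ t)
    summand c₀ r s ν t φ m sign power = ≈-sym (begin
      ƛ ^ c₀ * (- 1#) ^ r * (((1# - ƛ) - 1#) ^ s * (- ƛ) ^ ν * ƛ⁻¹ ^ t)
        ≈⟨ *-congˡ (*-congʳ (*-congʳ (^-congˡ s ([1-x]-1≈-x ƛ)))) ⟩
      ƛ ^ c₀ * (- 1#) ^ r * ((- ƛ) ^ s * (- ƛ) ^ ν * ƛ⁻¹ ^ t)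
        ≈⟨ *-congˡ (*-congʳ (^-homo-* (- ƛ) s ν)) ⟨
      ƛ ^ c₀ * (- 1#) ^ r * ((- ƛ) ^ (s + ν) * ƛ⁻¹ ^ t)
        ≈⟨ *-congˡ (*-congʳ (-x^n≈-1^n*x^n ƛ (s + ν))) ⟩
      ƛ ^ c₀ * (- 1#) ^ r * ((- 1#) ^ (s + ν) * ƛ ^ (s + ν) * ƛ⁻¹ ^ t)
        ≈⟨ *-assoc _ _ _ ⟨
      ƛ ^ c₀ * (- 1#) ^ r * ((- 1#) ^ (s + ν) * ƛ ^ (s + ν)) * ƛ⁻¹ ^ t
        ≈⟨ *-congʳ (*-congʳ (*-comm _ _)) ⟩
      (- 1#) ^ r * ƛ ^ c₀ * ((- 1#) ^ (s + ν) * ƛ ^ (s + ν)) * ƛ⁻¹ ^ t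
        ≈⟨ *-congʳ (interchange _ _ _ _) ⟩
      (- 1#) ^ r * (- 1#) ^ (s + ν) * (ƛ ^ c₀ * ƛ ^ (s + ν)) * ƛ⁻¹ ^ t
        ≈⟨ *-congʳ (*-cong (^-homo-* (- 1#) r (s + ν)) (^-homo-* ƛ c₀ (s + ν))) ⟨
      (- 1#) ^ (r + (s + ν)) * ƛ ^ (c₀ + (s + ν)) * ƛ⁻¹ ^ t
        ≈⟨ *-congʳ (*-cong (^-congʳ (- 1#) sign) (^-congʳ ƛ power)) ⟩
      (- 1#) ^ (m + (s + s)) * ƛ ^ (φ + t) * ƛ⁻¹ ^ t
        ≈⟨ *-assoc _ _ _ ⟩
      (- 1#) ^ (m + (s + s)) * (ƛ ^ (φ + t) * ƛ⁻¹ ^ t)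
        ≈⟨ *-cong even cancel ⟩
      (- 1#) ^ m * ƛ ^ φ ∎)
      where
      even : (- 1#) ^ (m + (s + s)) ≈ (- 1#) ^ m
      even = begin
        (- 1#) ^ (m + (s + s))           ≈⟨ ^-homo-* (- 1#) m (s + s) ⟩
        (- 1#) ^ m * (- 1#) ^ (s + s)    ≈⟨ *-congˡ (-1^[n+n]≈1 s) ⟩
        (- 1#) ^ m * 1#                  ≈⟨ *-identityʳ _ ⟩
        (- 1#) ^ m                       ∎

      cancel : ƛ ^ (φ + t) * ƛ⁻¹ ^ t ≈ ƛ ^ φ
      cancel = begin
        ƛ ^ (φ + t) * ƛ⁻¹ ^ t        ≈⟨ *-congʳ (^-homo-* ƛ φ t) ⟩
        ƛ ^ φ * ƛ ^ t * ƛ⁻¹ ^ t      ≈⟨ *-assoc _ _ _ ⟩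
        ƛ ^ φ * (ƛ ^ t * ƛ⁻¹ ^ t)    ≈⟨ *-congˡ (^-distrib-* ƛ ƛ⁻¹ t) ⟨
        ƛ ^ φ * (ƛ * ƛ⁻¹) ^ t        ≈⟨ *-congˡ (≈-trans (^-congˡ t inverse) (1^n≈1 t)) ⟩
        ƛ ^ φ * 1#                   ≈⟨ *-identityʳ _ ⟩
        ƛ ^ φ                        ∎

-- Exponents as honest differences

module Exponents (H : RibbonGraph) (A : Subset (RibbonGraph.#edges H)) where
  open ≡-Reasoning
  open +-*-Solver

  private
    v  = vertices H
    c₀ = c H
    cᴬ = components H A
    rᴬ = rank H A
    νᴬ = nullity H A
    s  = r H ∸ rᴬ

    c₀+r≡v : c₀ + r H ≡ v
    c₀+r≡v = ℕ.m+[n∸m]≡n (components≤vertices H ⊤)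

    cᴬ+rᴬ≡v : cᴬ + rᴬ ≡ v
    cᴬ+rᴬ≡v = ℕ.m+[n∸m]≡n (components≤vertices H A)

    rᴬ+s≡r : rᴬ + s ≡ r H
    rᴬ+s≡r = ℕ.m+[n∸m]≡n (ℕ.∸-monoʳ-≤ v (components-inclusion H A))

    rᴬ+νᴬ≡∣A∣ : rᴬ + νᴬ ≡ ∣ A ∣
    rᴬ+νᴬ≡∣A∣ = ℕ.m+[n∸m]≡n (ℕ.m≤n+o⇒m∸n≤o v cᴬ (vertices-bound H A))

    -- Both ranks are measured from the same `v`, so their difference is the difference of the
    -- component counts.
    c₀+s≡cᴬ : c₀ + s ≡ cᴬ
    c₀+s≡cᴬ = ℕ.+-cancelʳ-≡ rᴬ (c₀ + s) cᴬ (begin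
      c₀ + s + rᴬ     ≡⟨ solve 3 (λ c s r → c :+ s :+ r := c :+ (r :+ s)) refl c₀ s rᴬ ⟩
      c₀ + (rᴬ + s)   ≡⟨ cong (c₀ +_) rᴬ+s≡r ⟩
      c₀ + r H        ≡⟨ c₀+r≡v ⟩
      v               ≡⟨ cᴬ+rᴬ≡v ⟨
      cᴬ + rᴬ         ∎)

    -- This is Euler's inequality after substituting `rᴬ + νᴬ` for the number of edges and
    -- cancelling `v = cᴬ + rᴬ`.
    faces≤cᴬ+νᴬ : faces H A ≤ cᴬ + νᴬ
    faces≤cᴬ+νᴬ = ℕ.+-cancelʳ-≤ v (faces H A) (cᴬ + νᴬ)
      (subst (faces H A + v ≤_) rearranged (euler-inequality H A))
      where
      rearranged : cᴬ + cᴬ + ∣ A ∣ ≡ cᴬ + νᴬ + v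
      rearranged = begin
        cᴬ + cᴬ + ∣ A ∣         ≡⟨ cong (cᴬ + cᴬ +_) rᴬ+νᴬ≡∣A∣ ⟨
        cᴬ + cᴬ + (rᴬ + νᴬ)     ≡⟨ solve 3 (λ c r ν → c :+ c :+ (r :+ ν)
                                     := c :+ ν :+ (c :+ r)) refl cᴬ rᴬ νᴬ ⟩
        cᴬ + νᴬ + (cᴬ + rᴬ)     ≡⟨ cong (cᴬ + νᴬ +_) cᴬ+rᴬ≡v ⟩
        cᴬ + νᴬ + v             ∎

  sign-exponent : r H + (s + νᴬ) ≡ ∣ A ∣ + (s + s)
  sign-exponent = begin
    r H + (s + νᴬ)       ≡⟨ cong (_+ (s + νᴬ)) rᴬ+s≡r ⟨
    rᴬ + s + (s + νᴬ)    ≡⟨ solve 3 (λ r s ν → r :+ s :+ (s :+ ν)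
                              := r :+ ν :+ (s :+ s)) refl rᴬ s νᴬ ⟩
    rᴬ + νᴬ + (s + s)    ≡⟨ cong (_+ (s + s)) rᴬ+νᴬ≡∣A∣ ⟩
    ∣ A ∣ + (s + s)      ∎

  power-exponent : c₀ + (s + νᴬ) ≡ faces H A + ((cᴬ + νᴬ) ∸ faces H A)
  power-exponent = begin
    c₀ + (s + νᴬ)                            ≡⟨ ℕ.+-assoc c₀ s νᴬ ⟨
    c₀ + s + νᴬ                              ≡⟨ cong (_+ νᴬ) c₀+s≡cᴬ ⟩
    cᴬ + νᴬ                                  ≡⟨ ℕ.m+[n∸m]≡n faces≤cᴬ+νᴬ ⟨
    faces H A + ((cᴬ + νᴬ) ∸ faces H A)      ∎

theorem4p6 : ∀ {a ℓ} (K : CommutativeRing a ℓ) →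
    let open CommutativeRing K
        open Polynomials K
    in (G : RibbonGraph) (ƛ ƛ⁻¹ : Carrier) → ƛ * ƛ⁻¹ ≈ 1# →
       penrose (dual G) ƛ
         ≈ ƛ ^ c (petrieDual G) * (- 1#) ^ r (petrieDual G)
           * ribbonPolynomial (petrieDual G) (1# - ƛ) (- ƛ) ƛ⁻¹
theorem4p6 K G ƛ ƛ⁻¹ inverse = K.trans
  -- Duals and partial Petrials keep `#edges`, so both sums run over the same subsets; the prefactor
  -- is taken inside the sum and the summands are compared.
  (∑⊆-cong K #edges λ A → K.trans
    (K.*-congˡ (K.reflexive (cong (ƛ P.^_) (faces-dual-petrial G A))))
    (summand K ƛ ƛ⁻¹ inverse (c H) (r H) (r H ∸ rank H A) (nullity H A)
      ((components H A + nullity H A) ∸ faces H A) (faces H A) ∣ A ∣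
      (sign-exponent H A) (power-exponent H A)))
  (K.sym (*-distribˡ-∑⊆ K #edges (ƛ P.^ c H K.* (K.- K.1#) P.^ r H) _))
  where
  module K = CommutativeRing K
  module P = Polynomials K
  open RibbonGraph G using (#edges)
  open Exponents using (sign-exponent; power-exponent)
  H = petrieDual G
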